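{- Let $q$ be a prime power, $\mathbb{F}_q$ the finite field with $q$ elements, and let $d$ and $k$ be fixed positive integers with $d \geqslant 2k-1$. Let $E \subset \mathbb{F}_q^d$ be such that $$|E| \gg q^{\frac{d}{2} + k - 1}.$$ Then the number of $k$-tuples of $k$ mutually orthogonal vectors in $E$ is $$(1 + o(1)) \frac{|E|^k}{k!}\, q^{ -\binom{k}{2}}.$$
   Context: Two vectors $x=(x_1,\dots,x_d)$ and $y=(y_1,\dots,y_d)$ in $\mathbb{F}_q^d$ are orthogonal if $x_1y_1+\cdots+x_dy_d=0$. A "$k$-tuple of $k$ mutually orthogonal vectors in $E$" means an unordered collection of $k$ distinct vectors of $E$ that are pairwise orthogonal (hence the division by $k!$). Asymptotic notation is with $d,k$ fixed and $q\to\infty$: $|E| \gg f(q)$ means $|E|/f(q)\to\infty$, and $o(1)$ denotes a quantity tending to $0$. -}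

module Defs where

open import Algebra.Apartness.Structures using (IsHeytingField)
open import Data.Fin using (Fin)
open import Data.Fin.Properties using (inj⇒≟; nonZeroIndex)
open import Data.Integer using (+_)
open import Data.List using (List; []; _∷_; [_]; _++_; map; filter; length)
open import Data.List.Relation.Unary.AllPairs using (allPairs?)
open import Data.Nat using (ℕ; zero; suc; _*_; _^_; _≤_; _!; NonZero)
open import Data.Nat.Combinatorics using (_C_)
open import Data.Nat.Properties using (m^n≢0; m*n≢0; _!≢0)
open import Data.Product using (∃-syntax)
open import Data.Rational as ℚ using (ℚ; 0ℚ; ∣_∣)
open import Data.Vec as Vec using (Vec)
open import Function.Bundles using (_↔_; Inverse)
open import Function.Properties.Inverse using (Inverse⇒Injection)
open import Relation.Binary.Definitions using (DecidableEquality)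
open import Relation.Binary.PropositionalEquality using (_≡_; _≢_)
open import Relation.Nullary using (Dec)

-- With _≢_ as apartness, the Heyting field axioms are the usual field axioms:
-- invertible elements are exactly the nonzero ones (in particular 0# ≢ 1#).
-- A finite field has prime power order, so `order` ranges over prime powers.
record FiniteField : Set₁ where
  infixl 6 _+F_
  infixl 7 _*F_
  field
    Carrier        : Set
    _+F_ _*F_      : Carrier → Carrier → Carrier
    -F_            : Carrier → Carrier
    0F 1F          : Carrier
    isHeytingField : IsHeytingField _≡_ _≢_ _+F_ _*F_ -F_ 0F 1F
    order          : ℕ
    enumeration    : Carrier ↔ Fin order

  _≟F_ : DecidableEquality Carrier
  _≟F_ = inj⇒≟ (Inverse⇒Injection enumeration)

  order≢0 : NonZero order
  order≢0 = nonZeroIndex (Inverse.to enumeration 0F)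

  dot : ∀ {d} → Vec Carrier d → Vec Carrier d → Carrier
  dot x y = Vec.foldr′ _+F_ 0F (Vec.zipWith _*F_ x y)

  Orthogonal : ∀ {d} → Vec Carrier d → Vec Carrier d → Set
  Orthogonal x y = dot x y ≡ 0F

  orthogonal? : ∀ {d} (x y : Vec Carrier d) → Dec (Orthogonal x y)
  orthogonal? x y = dot x y ≟F 0F

open FiniteField public using (Carrier; order)

-- All sublists of length k. If xs has no repetitions, each k-element subset
-- of xs is listed exactly once.
combinations : ∀ {a} {A : Set a} → ℕ → List A → List (List A)
combinations zero    _        = [ [] ]
combinations (suc k) []       = []
combinations (suc k) (x ∷ xs) = map (x ∷_) (combinations k xs) ++ combinations (suc k) xs

-- A finite set E is given by a list without repetitions; tuples are
-- unordered and consist of distinct vectors, but no vector is required to be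
-- non-isotropic (orthogonality is only asked of distinct members).
orthogonalTuples : (F : FiniteField) {d : ℕ} → ℕ → List (Vec (Carrier F) d) → ℕ
orthogonalTuples F k E =
  length (filter (allPairs? (FiniteField.orthogonal? F)) (combinations k E))

-- |E|^k / k! · q^(- k choose 2)
mainTerm : (F : FiniteField) {d : ℕ} → ℕ → List (Vec (Carrier F) d) → ℚ
mainTerm F k E = + (length E ^ k) ℚ./ (k ! * order F ^ (k C 2))
  where instance
    _ = FiniteField.order≢0 F
    _ = k !≢0
    _ = m^n≢0 (order F) (k C 2)
    _ = m*n≢0 (k !) (order F ^ (k C 2))

-- Asymptotics along an arbitrary family of instances indexed by I, as the
-- parameter q i tends to infinity.
module Asymptotics {ℓ} {I : Set ℓ} (q : I → ℕ) where

  -- f / √g → ∞, with C √g ≤ f squared to stay within ℕ; the root is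
  -- needed because exponents such as d/2 may be half-integers.
  _≫√_ : (f g : I → ℕ) → Set ℓ
  f ≫√ g = ∀ (C : ℕ) → ∃[ Q ] (∀ i → Q ≤ q i → C ^ 2 * g i ≤ f i ^ 2)

  IsLittleO1 : (I → ℚ) → Set ℓ
  IsLittleO1 δ = ∀ (ε : ℚ) → 0ℚ ℚ.< ε → ∃[ Q ] (∀ i → Q ≤ q i → ∣ δ i ∣ ℚ.< ε)

{-# OPTIONS --safe #-}

-- For S ⊆ F^d, y ∈ F^d and c ∈ F let n(y,c) count the x ∈ S with y · x = c. Summed over all y and c, the variance
-- (q n(y,c) − |S|)² only sees pairs x ≠ x′ through the number of y with y · (x − x′) = 0, and comes out
-- below q^(d+2) |S|. Keeping c = 0 and applying Cauchy–Schwarz gives the mixing estimate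
--   (q e(P,S) − |P||S|)² ≤ 4 q^(d+2) |P||S|
-- for e(P,S) the number of orthogonal pairs of distinct vectors in P × S.
-- Let H(k,j) count the ordered orthogonal k-tuples y₁,…,y_k in E together with some x ∈ E orthogonal to
-- y₁,…,y_j; it interpolates between |E| O(k) and O(k+1), O counting ordered orthogonal tuples. Mixing, applied
-- to x and y_(j+1) with the other vectors fixed, and Cauchy–Schwarz over those other vectors give
--   (q H(k,j+1) − H(k,j))² ≤ 4 q^(d+2) H(k−1,j) O(k),
-- whence H(k,j) ~ |E|^(k+1) q^(−C(k,2)−j) by induction, provided |E|² ≫ q^(d+2k).
module Submission where

open import Defs
open import Level using (Level; 0ℓ)
open import Data.Integer using (+_)
open import Data.List using (List; length)
open import Data.List.Relation.Unary.Unique.Propositional using (Unique)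
open import Data.Nat using (ℕ; _+_; _*_; _∸_; _^_; _≤_; NonZero)
open import Data.Product using (Σ-syntax; _×_)
open import Data.Rational as ℚ using (ℚ; 1ℚ)
open import Data.Vec using (Vec)
open import Relation.Binary.PropositionalEquality using (_≡_)

open import Algebra.Apartness.Structures using (IsHeytingField)
open import Algebra.Bundles using (CommutativeRing)
import Algebra.Properties.AbelianGroup as AbelianGroupProperties
open import Data.Bool using (if_then_else_; true; false)
open import Data.Empty using (⊥-elim)
import Data.Integer as ℤ
import Data.Integer.Properties as ℤ
import Data.Integer.Tactic.RingSolver as ℤSolver
open import Data.List using ([]; _∷_; [_]; _++_; map; filter; allFin; cartesianProductWith)
open import Data.List.Membership.Propositional using (_∈_)
open import Data.List.Membership.Propositional.Properties using (∈-∃++; ∈-++⁻; ∈-++⁺ˡ; ∈-++⁺ʳ; ∈-map⁺; ∈-allFin; ∈-cartesianProductWith⁺)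
open import Data.List.Properties using (map-++; map-∘; map-cong; filter-++; length-++; length-map; length-tabulate)
open import Data.List.Relation.Unary.All as All using (All; []; _∷_; all?)
open import Data.List.Relation.Unary.AllPairs using ([]; _∷_; allPairs?)
open import Data.List.Relation.Unary.Any using (here; there)
import Data.List.Relation.Unary.Unique.Propositional.Properties as Unique
open import Data.Nat
open import Data.Nat.Combinatorics using (_C_; nC1≡n; nCk+nC[k+1]≡[n+1]C[k+1])
open import Data.Nat.ListAction using (sum)
open import Data.Nat.ListAction.Properties using (sum-++)
open import Data.Nat.Properties
open import Data.Nat.Tactic.RingSolver using (solve-∀)
open import Data.Product using (_,_; proj₂)
open import Data.Rational using (0ℚ; toℚᵘ; mkℚ; *<*; ↧ₙ_)
import Data.Rational.Properties as ℚ
import Data.Rational.Unnormalised as ℚᵘ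
import Data.Rational.Unnormalised.Properties as ℚᵘ
open import Data.Sum using (inj₁; inj₂)
open import Data.Vec using ([]; _∷_)
open import Data.Vec.Properties using (≡-dec)
open import Function using (_∘_; _⇔_; mk⇔; Inverse)
open import Relation.Binary.Definitions using (DecidableEquality; Symmetric)
open import Relation.Binary.PropositionalEquality hiding ([_])
import Relation.Binary.Reasoning.Setoid as ≈-Reasoning
open import Relation.Nullary using (Dec; yes; no; does; ¬_; ¬?; _×-dec_)
open import Relation.Nullary.Decidable using (does-⇔)
open import Relation.Unary using (Pred; Decidable)

private variable
  A B Z : Set
  ℓ₁ : Level

-- Sums over lists

dist-+ : ∀ a b c d → ∣ a + b - c + d ∣ ≤ ∣ a - c ∣ + ∣ b - d ∣
dist-+ a b c d = begin
  ∣ a + b - c + d ∣                      ≤⟨ ∣-∣-triangle (a + b) (c + b) (c + d) ⟩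
  ∣ a + b - c + b ∣ + ∣ c + b - c + d ∣  ≡⟨ cong₂ _+_ cancelʳ (∣m+n-m+o∣≡∣n-o∣ c b d) ⟩
  ∣ a - c ∣ + ∣ b - d ∣                  ∎
  where
  open ≤-Reasoning
  cancelʳ : ∣ a + b - c + b ∣ ≡ ∣ a - c ∣
  cancelʳ = trans (cong₂ ∣_-_∣ (+-comm a b) (+-comm c b)) (∣m+n-m+o∣≡∣n-o∣ b a c)

-- The binomial formula with its cross term moved to the left, so that it holds in ℕ without
-- truncated subtraction.
dist² : ∀ a b → ∣ a - b ∣ * ∣ a - b ∣ + 2 * (a * b) ≡ a * a + b * b
dist² a b with ≤-total a b
... | inj₁ a≤b with k , refl ← m≤n⇒∃[o]m+o≡n a≤b rewrite ∣m-m+n∣≡n a k = identity a k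
  where
  identity : ∀ a k → k * k + 2 * (a * (a + k)) ≡ a * a + (a + k) * (a + k)
  identity = solve-∀
... | inj₂ b≤a with k , refl ← m≤n⇒∃[o]m+o≡n b≤a
                 rewrite ∣-∣-comm (b + k) b | ∣m-m+n∣≡n b k = identity b k
  where
  identity : ∀ b k → k * k + 2 * ((b + k) * b) ≡ (b + k) * (b + k) + b * b
  identity = solve-∀

m*m≤n*n⇒m≤n : ∀ {m n} → m * m ≤ n * n → m ≤ n
m*m≤n*n⇒m≤n {m} {n} mm≤nn with m ≤? n
... | yes m≤n = m≤n
... | no  m≰n = ⊥-elim (≤⇒≯ mm≤nn (*-mono-< (≰⇒> m≰n) (≰⇒> m≰n)))

4mn≤[m+n]² : ∀ m n → 4 * (m * n) ≤ (m + n) * (m + n)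
4mn≤[m+n]² m n = begin
  4 * (m * n)                                            ≤⟨ m≤n+m _ (∣ m - n ∣ * ∣ m - n ∣) ⟩
  ∣ m - n ∣ * ∣ m - n ∣ + 4 * (m * n)                    ≡⟨ split (∣ m - n ∣ * ∣ m - n ∣) m n ⟩
  (∣ m - n ∣ * ∣ m - n ∣ + 2 * (m * n)) + 2 * (m * n)    ≡⟨ cong (_+ 2 * (m * n)) (dist² m n) ⟩
  (m * m + n * n) + 2 * (m * n)                          ≡⟨ square m n ⟩
  (m + n) * (m + n)                                      ∎
  where
  open ≤-Reasoning
  split : ∀ s m n → s + 4 * (m * n) ≡ (s + 2 * (m * n)) + 2 * (m * n)
  split = solve-∀
  square : ∀ m n → (m * m + n * n) + 2 * (m * n) ≡ (m + n) * (m + n)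
  square = solve-∀

-- Cauchy-Schwarz for two terms, free of square roots. AM-GM for `k * (b * f)` and `k * (e * c)`,
-- whose product equals that of the two given bounds, controls the cross term `2 * (x * y)`.
cauchy-schwarz₂ : ∀ k x y b c e f → x * x ≤ k * (b * c) → y * y ≤ k * (e * f) →
                  (x + y) * (x + y) ≤ k * ((b + e) * (c + f))
cauchy-schwarz₂ k x y b c e f x² y² = begin
  (x + y) * (x + y)                                          ≡⟨ expand x y ⟩
  x * x + y * y + 2 * (x * y)                                ≤⟨ +-mono-≤ (+-mono-≤ x² y²) cross ⟩
  k * (b * c) + k * (e * f) + (k * (b * f) + k * (e * c))    ≡⟨ collect k b c e f ⟩
  k * ((b + e) * (c + f))                                    ∎
  where
  open ≤-Reasoning
  expand : ∀ x y → (x + y) * (x + y) ≡ x * x + y * y + 2 * (x * y)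
  expand = solve-∀
  collect : ∀ k b c e f → k * (b * c) + k * (e * f) + (k * (b * f) + k * (e * c)) ≡ k * ((b + e) * (c + f))
  collect = solve-∀
  regroup₁ : ∀ x y → 2 * (x * y) * (2 * (x * y)) ≡ 4 * ((x * x) * (y * y))
  regroup₁ = solve-∀
  regroup₂ : ∀ k b c e f → (k * (b * c)) * (k * (e * f)) ≡ (k * (b * f)) * (k * (e * c))
  regroup₂ = solve-∀
  cross : 2 * (x * y) ≤ k * (b * f) + k * (e * c)
  cross = m*m≤n*n⇒m≤n (begin
    2 * (x * y) * (2 * (x * y))              ≡⟨ regroup₁ x y ⟩
    4 * ((x * x) * (y * y))                  ≤⟨ *-monoʳ-≤ 4 (*-mono-≤ x² y²) ⟩
    4 * ((k * (b * c)) * (k * (e * f)))      ≡⟨ cong (4 *_) (regroup₂ k b c e f) ⟩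
    4 * ((k * (b * f)) * (k * (e * c)))      ≤⟨ 4mn≤[m+n]² (k * (b * f)) (k * (e * c)) ⟩
    (k * (b * f) + k * (e * c)) * (k * (b * f) + k * (e * c)) ∎)

infixr 10 ∑
∑ : List A → (A → ℕ) → ℕ
∑ xs f = sum (map f xs)

syntax ∑ xs (λ x → e) = ∑[ x ∈ xs ] e

∑-cong : ∀ {f g : A → ℕ} → (∀ x → f x ≡ g x) → ∀ xs → ∑ xs f ≡ ∑ xs g
∑-cong f≗g xs = cong sum (map-cong f≗g xs)

∑-mono : ∀ {f g : A → ℕ} → (∀ x → f x ≤ g x) → ∀ xs → ∑ xs f ≤ ∑ xs g
∑-mono f≤g []       = z≤n
∑-mono f≤g (x ∷ xs) = +-mono-≤ (f≤g x) (∑-mono f≤g xs)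

∑-distrib-+ : ∀ (f g : A → ℕ) xs → ∑ xs (λ x → f x + g x) ≡ ∑ xs f + ∑ xs g
∑-distrib-+ f g []       = refl
∑-distrib-+ f g (x ∷ xs) rewrite ∑-distrib-+ f g xs = interchange (f x) (g x) (∑ xs f) (∑ xs g)
  where
  interchange : ∀ a b c d → (a + b) + (c + d) ≡ (a + c) + (b + d)
  interchange = solve-∀

∑-*ˡ : ∀ c (f : A → ℕ) xs → ∑ xs (λ x → c * f x) ≡ c * ∑ xs f
∑-*ˡ c f []       = sym (*-zeroʳ c)
∑-*ˡ c f (x ∷ xs) rewrite ∑-*ˡ c f xs = sym (*-distribˡ-+ c (f x) (∑ xs f))

∑-const : ∀ c (xs : List A) → ∑ xs (λ _ → c) ≡ length xs * c
∑-const c []       = refl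
∑-const c (x ∷ xs) = cong (_+_ c) (∑-const c xs)

∑-swap : ∀ (f : A → B → ℕ) xs ys →
         ∑ xs (λ x → ∑ ys (f x)) ≡ ∑ ys (λ y → ∑ xs (λ x → f x y))
∑-swap f []       ys = sym (trans (∑-const 0 ys) (*-zeroʳ (length ys)))
∑-swap f (x ∷ xs) ys rewrite ∑-swap f xs ys = sym (∑-distrib-+ (f x) (λ y → ∑ xs (λ x → f x y)) ys)

∑-dist : ∀ (f g : A → ℕ) xs → ∣ ∑ xs f - ∑ xs g ∣ ≤ ∑ xs (λ x → ∣ f x - g x ∣)
∑-dist f g []       = z≤n
∑-dist f g (x ∷ xs) = ≤-trans (dist-+ (f x) (∑ xs f) (g x) (∑ xs g)) (+-monoʳ-≤ ∣ f x - g x ∣ (∑-dist f g xs))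

cauchy-schwarz : ∀ k (f g h : A → ℕ) → (∀ x → f x * f x ≤ k * (g x * h x)) →
                 ∀ xs → ∑ xs f * ∑ xs f ≤ k * (∑ xs g * ∑ xs h)
cauchy-schwarz k f g h f²≤kgh []       = z≤n
cauchy-schwarz k f g h f²≤kgh (x ∷ xs) =
  cauchy-schwarz₂ k (f x) (∑ xs f) (g x) (h x) (∑ xs g) (∑ xs h) (f²≤kgh x) (cauchy-schwarz k f g h f²≤kgh xs)

-- Sums a squared error estimate over a parameter: a bound valid for each fixed vertex becomes one
-- for the total over that vertex.
cauchy-schwarz-dist : ∀ k (f g b c : A → ℕ) →
  (∀ x → ∣ f x - g x ∣ * ∣ f x - g x ∣ ≤ k * (b x * c x)) →
  ∀ xs → ∣ ∑ xs f - ∑ xs g ∣ * ∣ ∑ xs f - ∑ xs g ∣ ≤ k * (∑ xs b * ∑ xs c)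
cauchy-schwarz-dist k f g b c h xs =
  ≤-trans (*-mono-≤ (∑-dist f g xs) (∑-dist f g xs)) (cauchy-schwarz k (λ x → ∣ f x - g x ∣) b c h xs)

-- Indicator functions as summands

ι : ∀ {p} {P : Set p} → Dec P → ℕ
ι P? = if does P? then 1 else 0

ι-⇔ : ∀ {p q} {P : Set p} {Q : Set q} → P ⇔ Q → (P? : Dec P) (Q? : Dec Q) → ι P? ≡ ι Q?
ι-⇔ P⇔Q P? Q? rewrite does-⇔ P⇔Q P? Q? = refl

ι≤1 : ∀ {p} {P : Set p} (P? : Dec P) → ι P? ≤ 1
ι≤1 (yes _) = ≤-refl
ι≤1 (no  _) = z≤n

∑-filter : ∀ {P : Pred A ℓ₁} (P? : Decidable P) (f : A → ℕ) xs →
           ∑ (filter P? xs) f ≡ ∑ xs (λ x → ι (P? x) * f x)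
∑-filter P? f []       = refl
∑-filter P? f (x ∷ xs) with does (P? x)
... | true  = cong₂ _+_ (sym (*-identityˡ (f x))) (∑-filter P? f xs)
... | false = ∑-filter P? f xs

length≡∑ : ∀ (xs : List A) → length xs ≡ ∑ xs (λ _ → 1)
length≡∑ xs = sym (trans (∑-const 1 xs) (*-identityʳ (length xs)))

length-filter≡∑ : ∀ {P : Pred A ℓ₁} (P? : Decidable P) xs → length (filter P? xs) ≡ ∑ xs (λ x → ι (P? x))
length-filter≡∑ P? xs = trans (length≡∑ (filter P? xs))
  (trans (∑-filter P? (λ _ → 1) xs) (∑-cong (λ x → *-identityʳ (ι (P? x))) xs))

∑-++ : ∀ (f : A → ℕ) xs ys → ∑ (xs ++ ys) f ≡ ∑ xs f + ∑ ys f
∑-++ f xs ys = trans (cong sum (map-++ f xs ys)) (sum-++ (map f xs) (map f ys))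

-- Induction on `xs` deletes one occurrence of the head from `ys`. The head does not recur in `xs`,
-- so the tail still lies in what is left.
∑-⊆ : ∀ (f : A → ℕ) {xs ys} → Unique xs → (∀ {x} → x ∈ xs → x ∈ ys) → ∑ xs f ≤ ∑ ys f
∑-⊆ f {[]}     _  _ = z≤n
∑-⊆ f {x ∷ xs} {ys} u@(_ ∷ uxs) xs⊆ys with us , vs , refl ← ∈-∃++ (xs⊆ys (here refl)) = begin
  f x + ∑ xs f                ≤⟨ +-monoʳ-≤ (f x) (∑-⊆ f uxs without) ⟩
  f x + ∑ (us ++ vs) f        ≡⟨ cong (_+_ (f x)) (∑-++ f us vs) ⟩
  f x + (∑ us f + ∑ vs f)     ≡⟨ rotate (f x) (∑ us f) (∑ vs f) ⟩
  ∑ us f + (f x + ∑ vs f)     ≡⟨ ∑-++ f us (x ∷ vs) ⟨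
  ∑ (us ++ [ x ] ++ vs) f     ∎
  where
  open ≤-Reasoning
  rotate : ∀ a b c → a + (b + c) ≡ b + (a + c)
  rotate = solve-∀
  without : ∀ {y} → y ∈ xs → y ∈ us ++ vs
  without y∈xs with ∈-++⁻ us (xs⊆ys (there y∈xs))
  ... | inj₁ y∈us          = ∈-++⁺ˡ y∈us
  ... | inj₂ (here refl)   = ⊥-elim (Unique.Unique[x∷xs]⇒x∉xs u y∈xs)
  ... | inj₂ (there y∈vs)  = ∈-++⁺ʳ us y∈vs

module _ (_≟_ : DecidableEquality A) where

  ∑-ι≡-∉ : ∀ {a} (g : A → ℕ) {xs} → All (a ≢_) xs → ∑ xs (λ x → ι (a ≟ x) * g x) ≡ 0
  ∑-ι≡-∉ g []           = refl
  ∑-ι≡-∉ {a} g {x ∷ xs} (a≢x ∷ a∉xs) with a ≟ x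
  ... | yes a≡x = ⊥-elim (a≢x a≡x)
  ... | no  _   = ∑-ι≡-∉ g a∉xs

  ∑-ι≡ : ∀ {a} (g : A → ℕ) {xs} → Unique xs → a ∈ xs → ∑ xs (λ x → ι (a ≟ x) * g x) ≡ g a
  ∑-ι≡ {a} g {x ∷ xs} (x∉xs ∷ uxs) a∈xs with a ≟ x
  ... | yes refl rewrite ∑-ι≡-∉ g x∉xs = trans (+-identityʳ _) (*-identityˡ (g a))
  ∑-ι≡ {a} g {x ∷ xs} (x∉xs ∷ uxs) (here a≡x)   | no a≢x = ⊥-elim (a≢x a≡x)
  ∑-ι≡ {a} g {x ∷ xs} (x∉xs ∷ uxs) (there a∈xs) | no _   = ∑-ι≡ g uxs a∈xs

∑-ι≤1 : ∀ {P : Pred A ℓ₁} (P? : Decidable P) {xs} → Unique xs →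
        (∀ {x y} → P x → P y → x ≡ y) → ∑ xs (λ x → ι (P? x)) ≤ 1
∑-ι≤1 P? [] _ = z≤n
∑-ι≤1 {P = P} P? {x ∷ xs} (x∉xs ∷ uxs) P-unique with P? x
... | no  _  = ∑-ι≤1 P? uxs P-unique
... | yes Px = s≤s (≤-reflexive (none x∉xs))
  where
  none : ∀ {ys} → All (x ≢_) ys → ∑ ys (λ y → ι (P? y)) ≡ 0
  none []                  = refl
  none {y ∷ ys} (x≢y ∷ x∉ys) with P? y
  ... | yes Py = ⊥-elim (x≢y (P-unique Px Py))
  ... | no  _  = none x∉ys

-- Counting cliques

filter-comm : ∀ {r s} {P : Pred A r} {Q : Pred A s} (P? : Decidable P) (Q? : Decidable Q) xs →
              filter P? (filter Q? xs) ≡ filter Q? (filter P? xs)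
filter-comm P? Q? [] = refl
filter-comm P? Q? (x ∷ xs) with does (Q? x) in qx | does (P? x) in px
... | true  | true  rewrite px | qx = cong (x ∷_) (filter-comm P? Q? xs)
... | true  | false rewrite px = filter-comm P? Q? xs
... | false | true  rewrite qx = filter-comm P? Q? xs
... | false | false = filter-comm P? Q? xs

filter-cong : ∀ {r s} {P : Pred A r} {Q : Pred A s} (P? : Decidable P) (Q? : Decidable Q) {xs} →
              All (λ x → does (P? x) ≡ does (Q? x)) xs → filter P? xs ≡ filter Q? xs
filter-cong P? Q? [] = refl
filter-cong P? Q? {x ∷ xs} (eq ∷ eqs) rewrite eq with does (Q? x)
... | true  = cong (x ∷_) (filter-cong P? Q? eqs)
... | false = filter-cong P? Q? eqs

module Cliques {r} {V : Set} {R : V → V → Set r} (R? : ∀ x y → Dec (R x y)) where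

  nbr : V → List V → List V
  nbr x = filter (R? x)

  -- Expander mixing at edge density 1/q, cleared of denominators and roots. All duplicate-free `P`
  -- and `S` are allowed because the bound is applied inside common neighbourhoods.
  IsMixing : ℕ → ℕ → Set
  IsMixing q K = ∀ {P S : List V} → Unique P → Unique S →
    let e = q * ∑[ y ∈ P ] length (nbr y S)
        f = length P * length S
    in ∣ e - f ∣ * ∣ e - f ∣ ≤ K * f

  -- Unordered cliques: each is counted at its earliest vertex in the list, the others being later
  -- neighbours of it.
  cliques : ℕ → List V → ℕ
  cliques zero    _        = 1
  cliques (suc k) []       = 0
  cliques (suc k) (x ∷ xs) = cliques k (nbr x xs) + cliques (suc k) xs

  -- Moves the test from the chosen lists to the vertices, which turns filtering of `combinations`
  -- into the recursion of `cliques`.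
  filter-all-combinations : ∀ x k xs → filter (all? (R? x)) (combinations k xs) ≡ combinations k (nbr x xs)
  filter-all-combinations x zero    xs       = refl
  filter-all-combinations x (suc k) []       = refl
  filter-all-combinations x (suc k) (y ∷ ys)
    rewrite filter-++ (all? (R? x)) (map (y ∷_) (combinations k ys)) (combinations (suc k) ys)
          | filter-all-combinations x (suc k) ys
    with does (R? x y) in eq
  ... | true  = cong (_++ combinations (suc k) (nbr x ys))
                  (trans (accept (combinations k ys)) (cong (map (y ∷_)) (filter-all-combinations x k ys)))
    where
    accept : ∀ cs → filter (all? (R? x)) (map (y ∷_) cs) ≡ map (y ∷_) (filter (all? (R? x)) cs)
    accept []       = refl
    accept (c ∷ cs) rewrite eq with does (all? (R? x) c)
    ... | true  = cong ((y ∷ c) ∷_) (accept cs)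
    ... | false = accept cs
  ... | false = cong (_++ combinations (suc k) (nbr x ys)) (reject (combinations k ys))
    where
    reject : ∀ cs → filter (all? (R? x)) (map (y ∷_) cs) ≡ []
    reject []       = refl
    reject (c ∷ cs) rewrite eq = reject cs

  length-filter-cons : ∀ x cs → length (filter (allPairs? R?) (map (x ∷_) cs))
                              ≡ length (filter (allPairs? R?) (filter (all? (R? x)) cs))
  length-filter-cons x []       = refl
  length-filter-cons x (c ∷ cs) with does (all? (R? x) c)
  ... | false = length-filter-cons x cs
  ... | true with does (allPairs? R? c)
  ...   | true  = cong suc (length-filter-cons x cs)
  ...   | false = length-filter-cons x cs

  length-filter-combinations : ∀ k xs → length (filter (allPairs? R?) (combinations k xs)) ≡ cliques k xs
  length-filter-combinations zero    xs       = refl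
  length-filter-combinations (suc k) []       = refl
  length-filter-combinations (suc k) (x ∷ xs) = begin
    length (filter P? (map (x ∷_) (combinations k xs) ++ combinations (suc k) xs))
      ≡⟨ cong length (filter-++ P? (map (x ∷_) (combinations k xs)) (combinations (suc k) xs)) ⟩
    length (filter P? (map (x ∷_) (combinations k xs)) ++ filter P? (combinations (suc k) xs))
      ≡⟨ length-++ (filter P? (map (x ∷_) (combinations k xs))) ⟩
    length (filter P? (map (x ∷_) (combinations k xs))) + length (filter P? (combinations (suc k) xs))
      ≡⟨ cong₂ _+_ first (length-filter-combinations (suc k) xs) ⟩
    cliques k (nbr x xs) + cliques (suc k) xs ∎
    where
    open ≡-Reasoning
    P? = allPairs? R?
    first : length (filter P? (map (x ∷_) (combinations k xs))) ≡ cliques k (nbr x xs)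
    first = trans (length-filter-cons x (combinations k xs))
      (trans (cong (length ∘ filter P?) (filter-all-combinations x k xs)) (length-filter-combinations k (nbr x xs)))

  -- Ordered cliques, with or without a further common neighbour

  ordered : ℕ → List V → ℕ
  ordered zero    P = 1
  ordered (suc k) P = ∑[ x ∈ P ] ordered k (nbr x P)

  -- The number of ordered k-cliques y₁,…,y_k in P with a vertex of S adjacent to y₁,…,y_j
  -- (only meaningful for j ≤ k).
  pointed : ℕ → ℕ → List V → List V → ℕ
  pointed k       zero    P S = length S * ordered k P
  pointed zero    (suc j) P S = 0
  pointed (suc k) (suc j) P S = ∑[ y ∈ P ] pointed k j (nbr y P) (nbr y S)

  -- The sum of w x over ordered k-cliques in P and common neighbours x ∈ Q of their vertices.
  weighted : (V → ℕ) → ℕ → List V → List V → ℕ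
  weighted w zero    P Q = ∑ Q w
  weighted w (suc k) P Q = ∑[ y ∈ P ] weighted w k (nbr y P) (nbr y Q)

  module SymmetricCliques (R-sym : Symmetric R) where

    ι-sym : ∀ x y → ι (R? x y) ≡ ι (R? y x)
    ι-sym x y = ι-⇔ (mk⇔ R-sym R-sym) (R? x y) (R? y x)

    ∑-nbr-swap : ∀ (f : V → V → ℕ) P Q → ∑[ y ∈ P ] ∑ (nbr y Q) (f y) ≡ ∑[ x ∈ Q ] ∑ (nbr x P) (λ y → f y x)
    ∑-nbr-swap f P Q = begin
      ∑[ y ∈ P ] ∑ (nbr y Q) (f y)                   ≡⟨ ∑-cong (λ y → ∑-filter (R? y) (f y) Q) P ⟩
      ∑[ y ∈ P ] ∑[ x ∈ Q ] (ι (R? y x) * f y x)     ≡⟨ ∑-swap (λ y x → ι (R? y x) * f y x) P Q ⟩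
      ∑[ x ∈ Q ] ∑[ y ∈ P ] (ι (R? y x) * f y x)     ≡⟨ ∑-cong (λ x → ∑-cong (λ y → cong (_* f y x) (ι-sym y x)) P) Q ⟩
      ∑[ x ∈ Q ] ∑[ y ∈ P ] (ι (R? x y) * f y x)     ≡⟨ ∑-cong (λ x → ∑-filter (R? x) (λ y → f y x) P) Q ⟨
      ∑[ x ∈ Q ] ∑ (nbr x P) (λ y → f y x)           ∎
      where open ≡-Reasoning

    -- Double counting: the common neighbour `x` is chosen first, and by symmetry the clique then
    -- lies in the neighbourhood of `x`.
    weighted≡ : ∀ w k P Q → weighted w k P Q ≡ ∑[ x ∈ Q ] (w x * ordered k (nbr x P))
    weighted≡ w zero    P Q = ∑-cong (λ x → sym (*-identityʳ (w x))) Q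
    weighted≡ w (suc k) P Q = begin
      ∑[ y ∈ P ] weighted w k (nbr y P) (nbr y Q)
        ≡⟨ ∑-cong (λ y → weighted≡ w k (nbr y P) (nbr y Q)) P ⟩
      ∑[ y ∈ P ] ∑[ x ∈ nbr y Q ] (w x * ordered k (nbr x (nbr y P)))
        ≡⟨ ∑-nbr-swap (λ y x → w x * ordered k (nbr x (nbr y P))) P Q ⟩
      ∑[ x ∈ Q ] ∑[ y ∈ nbr x P ] (w x * ordered k (nbr x (nbr y P)))
        ≡⟨ ∑-cong (λ x → ∑-cong (λ y → cong (λ N → w x * ordered k N) (filter-comm (R? x) (R? y) P)) (nbr x P)) Q ⟩
      ∑[ x ∈ Q ] ∑[ y ∈ nbr x P ] (w x * ordered k (nbr y (nbr x P)))
        ≡⟨ ∑-cong (λ x → ∑-*ˡ (w x) (λ y → ordered k (nbr y (nbr x P))) (nbr x P)) Q ⟩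
      ∑[ x ∈ Q ] (w x * ordered (suc k) (nbr x P)) ∎
      where open ≡-Reasoning

    pointed-full : ∀ k P S → pointed k k P S ≡ weighted (λ _ → 1) k P S
    pointed-full zero    P S = trans (*-identityʳ (length S)) (length≡∑ S)
    pointed-full (suc k) P S = ∑-cong (λ y → pointed-full k (nbr y P) (nbr y S)) P

    weighted-1 : ∀ k P → weighted (λ _ → 1) k P P ≡ ordered (suc k) P
    weighted-1 k P = trans (weighted≡ (λ _ → 1) k P P) (∑-cong (λ x → *-identityˡ (ordered k (nbr x P))) P)

    -- A common neighbour of all k vertices, taken from the same list, is one more clique vertex.
    -- This passes from k-cliques to (k+1)-cliques in the main induction.
    ordered-suc : ∀ k P → ordered (suc k) P ≡ pointed k k P P
    ordered-suc k P = sym (trans (pointed-full k P P) (weighted-1 k P))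

    module Loopless (R-irrefl : ∀ {x} → ¬ R x x) where

      -- A clique is counted once at each of its vertices. In the induction on the list, the cliques
      -- through the head `z` are counted once at `z` and, by induction on the size inside
      -- `nbr z zs`, once at each other vertex.
      ∑-cliques-nbr : ∀ k P → ∑[ x ∈ P ] cliques k (nbr x P) ≡ suc k * cliques (suc k) P
      ∑-cliques-nbr zero [] = refl
      ∑-cliques-nbr zero (z ∷ zs) = cong suc (∑-cliques-nbr zero zs)
      ∑-cliques-nbr (suc k) [] = sym (*-zeroʳ (2 + k))
      ∑-cliques-nbr (suc k) (z ∷ zs) = begin
        cliques (suc k) (nbr z (z ∷ zs)) + ∑[ x ∈ zs ] cliques (suc k) (nbr x (z ∷ zs))
          ≡⟨ cong₂ _+_ head (tail (∑-cliques-nbr k (nbr z zs)) (∑-cliques-nbr (suc k) zs)) ⟩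
        T + (suc k * T + (2 + k) * cliques (2 + k) zs)
          ≡⟨ collect k T (cliques (2 + k) zs) ⟩
        (2 + k) * (T + cliques (2 + k) zs) ∎
        where
        open ≡-Reasoning
        T = cliques (suc k) (nbr z zs)
        collect : ∀ k a b → a + ((1 + k) * a + (2 + k) * b) ≡ (2 + k) * (a + b)
        collect = solve-∀
        -- Irreflexivity keeps `z` out of its own neighbourhood.
        head : cliques (suc k) (nbr z (z ∷ zs)) ≡ T
        head with R? z z
        ... | yes Rzz = ⊥-elim (R-irrefl Rzz)
        ... | no  _   = refl
        -- Cliques in the neighbourhood of `x` split into those that use `z`, possible only if `z`
        -- is adjacent to `x`, and those inside `zs`.
        through : ∀ x → cliques (suc k) (nbr x (z ∷ zs))
                      ≡ ι (R? z x) * cliques k (nbr x (nbr z zs)) + cliques (suc k) (nbr x zs)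
        through x rewrite ι-sym z x | filter-comm (R? x) (R? z) zs with does (R? x z)
        ... | true  = cong (_+ cliques (suc k) (nbr x zs)) (sym (*-identityˡ (cliques k (nbr z (nbr x zs)))))
        ... | false = refl
        tail : ∑[ x ∈ nbr z zs ] cliques k (nbr x (nbr z zs)) ≡ suc k * T →
               ∑[ x ∈ zs ] cliques (suc k) (nbr x zs) ≡ (2 + k) * cliques (2 + k) zs →
               ∑[ x ∈ zs ] cliques (suc k) (nbr x (z ∷ zs)) ≡ suc k * T + (2 + k) * cliques (2 + k) zs
        tail ih-nbr ih-zs = begin
          ∑[ x ∈ zs ] cliques (suc k) (nbr x (z ∷ zs))
            ≡⟨ ∑-cong through zs ⟩
          ∑[ x ∈ zs ] (ι (R? z x) * cliques k (nbr x (nbr z zs)) + cliques (suc k) (nbr x zs))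
            ≡⟨ ∑-distrib-+ (λ x → ι (R? z x) * cliques k (nbr x (nbr z zs))) (λ x → cliques (suc k) (nbr x zs)) zs ⟩
          ∑[ x ∈ zs ] (ι (R? z x) * cliques k (nbr x (nbr z zs))) + ∑[ x ∈ zs ] cliques (suc k) (nbr x zs)
            ≡⟨ cong₂ _+_ (sym (∑-filter (R? z) (λ x → cliques k (nbr x (nbr z zs))) zs)) ih-zs ⟩
          ∑[ x ∈ nbr z zs ] cliques k (nbr x (nbr z zs)) + (2 + k) * cliques (2 + k) zs
            ≡⟨ cong (_+ (2 + k) * cliques (2 + k) zs) ih-nbr ⟩
          suc k * T + (2 + k) * cliques (2 + k) zs ∎

      ordered≡!*cliques : ∀ k P → ordered k P ≡ k ! * cliques k P
      ordered≡!*cliques zero    P = refl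
      ordered≡!*cliques (suc k) P = begin
        ∑[ x ∈ P ] ordered k (nbr x P)             ≡⟨ ∑-cong (λ x → ordered≡!*cliques k (nbr x P)) P ⟩
        ∑[ x ∈ P ] (k ! * cliques k (nbr x P))     ≡⟨ ∑-*ˡ (k !) (λ x → cliques k (nbr x P)) P ⟩
        k ! * ∑[ x ∈ P ] cliques k (nbr x P)       ≡⟨ cong (k ! *_) (∑-cliques-nbr k P) ⟩
        k ! * (suc k * cliques (suc k) P)          ≡⟨ shuffle (k !) (suc k) (cliques (suc k) P) ⟩
        suc k * k ! * cliques (suc k) P            ∎
        where
        open ≡-Reasoning
        shuffle : ∀ a b c → a * (b * c) ≡ b * a * c
        shuffle = solve-∀

    module Mixing (q K : ℕ) (mixing : IsMixing q K) where

      degree : List V → V → ℕ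
      degree S y = length (nbr y S)

      unique-nbr : ∀ y {P} → Unique P → Unique (nbr y P)
      unique-nbr y = Unique.filter⁺ (R? y)

      -- Once the clique is fixed, `mixing` applies to its common neighbours in `Q` against all of
      -- `S`; Cauchy-Schwarz then sums over the clique vertices one at a time. Since `S` is never
      -- cut down, the error carries the full factor `length S`.
      weighted-mixing : ∀ k {P Q S} → Unique Q → Unique S →
        let a = q * weighted (degree S) k P Q
            c = weighted (λ _ → 1) k P Q
            b = length S * c
        in ∣ a - b ∣ * ∣ a - b ∣ ≤ K * ((length S * ordered k P) * c)
      weighted-mixing zero {P} {Q} {S} uQ uS
        rewrite sym (length≡∑ Q) | *-identityʳ (length S) | *-comm (length S) (length Q) = mixing uQ uS
      weighted-mixing (suc k) {P} {Q} {S} uQ uS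
        rewrite sym (∑-*ˡ q (λ y → weighted (degree S) k (nbr y P) (nbr y Q)) P)
              | sym (∑-*ˡ (length S) (λ y → weighted (λ _ → 1) k (nbr y P) (nbr y Q)) P)
              | sym (∑-*ˡ (length S) (λ y → ordered k (nbr y P)) P)
        = cauchy-schwarz-dist K
            (λ y → q * weighted (degree S) k (nbr y P) (nbr y Q))
            (λ y → length S * weighted (λ _ → 1) k (nbr y P) (nbr y Q))
            (λ y → length S * ordered k (nbr y P))
            (λ y → weighted (λ _ → 1) k (nbr y P) (nbr y Q))
            (λ y → weighted-mixing k (unique-nbr y uQ) uS) P

      -- The first j vertices cut down both `P` and `S`, one per induction step. At j = 0
      -- `weighted≡` reorders the choice, so that the first vertex is picked last, as a common
      -- neighbour of the other k, and can be mixed with the marked vertex in `S`.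
      pointed-step : ∀ k j {P S} → j ≤ k → Unique P → Unique S →
        let a = q * pointed (suc k) (suc j) P S
            b = pointed (suc k) j P S
        in ∣ a - b ∣ * ∣ a - b ∣ ≤ K * (pointed k j P S * ordered (suc k) P)
      pointed-step k zero {P} {S} _ uP uS =
        subst₂ (λ w o → ∣ q * w - length S * o ∣ * ∣ q * w - length S * o ∣ ≤ K * (length S * ordered k P * o))
          (weighted≡ (degree S) k P P) (weighted-1 k P) (weighted-mixing k uP uS)
      pointed-step (suc k) (suc j) {P} {S} (s≤s j≤k) uP uS
        rewrite sym (∑-*ˡ q (λ y → pointed (suc k) (suc j) (nbr y P) (nbr y S)) P)
        = cauchy-schwarz-dist K
            (λ y → q * pointed (suc k) (suc j) (nbr y P) (nbr y S))
            (λ y → pointed (suc k) j (nbr y P) (nbr y S))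
            (λ y → pointed k j (nbr y P) (nbr y S))
            (λ y → ordered (suc k) (nbr y P))
            (λ y → pointed-step k j j≤k (unique-nbr y uP) (unique-nbr y uS)) P

-- Clique counts in a mixing graph

-- Follows the recursion of `scaled-approx`. It depends only on k and j, so the estimates are
-- uniform in the field and the set.
errorBound : ℕ → ℕ → ℕ
errorBound zero    _       = 0
errorBound (suc k) zero    = errorBound k k
errorBound (suc k) (suc j) = 2 * ((1 + errorBound k j) * (1 + errorBound k k)) + errorBound (suc k) j

[1+k]C2 : ∀ k → suc k C 2 ≡ k C 2 + k
[1+k]C2 k = trans (sym (nCk+nC[k+1]≡[n+1]C[k+1] k 1)) (trans (cong (_+ k C 2) (nC1≡n k)) (+-comm k (k C 2)))

-- As c is at least 1, a relative error of e/c is at most e. This supplies the a priori bounds in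
-- `scaled-approx`.
dist≤⇒≤ : ∀ {c x y} e .{{_ : NonZero c}} → c * ∣ x - y ∣ ≤ e * y → x ≤ (1 + e) * y
dist≤⇒≤ {c} {x} {y} e h = ≤-trans (m≤n+∣m-n∣ x y) (+-monoʳ-≤ y (≤-trans (m≤n*m ∣ x - y ∣ c) h))

module MixingCliques {r} {V : Set} {R : V → V → Set r} (R? : ∀ x y → Dec (R x y)) (R-sym : Symmetric R)
  (q : ℕ) .{{_ : NonZero q}} (d : ℕ)
  (mixing : Cliques.IsMixing R? q (4 * q ^ (d + 2)))
  (E : List V) (E-unique : Unique E) (c : ℕ) .{{_ : NonZero c}} (n : ℕ)
  (large : c * c * q ^ (d + 2 * n) ≤ length E * length E) where

  open Cliques R?
  open SymmetricCliques R-sym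
  open Mixing q (4 * q ^ (d + 2)) mixing

  private m = length E

  -- Normalised to have expected value `m ^ suc k`: there are `k C 2` edges in the clique and j
  -- edges to the marked vertex, each of density 1/q.
  scaled : ℕ → ℕ → ℕ
  scaled k j = q ^ (k C 2 + j) * pointed k j E E

  scaled-ordered : ∀ k → q ^ (suc k C 2) * ordered (suc k) E ≡ scaled k k
  scaled-ordered k = cong₂ (λ e o → q ^ e * o) ([1+k]C2 k) (ordered-suc k E)

  -- Scaling turns the bound of `pointed-step` into 4 q^(d+2+k+j) times `scaled k j * scaled k k`.
  -- As j ≤ k < n, the hypothesis `large` trades c² q^(d+2+k+j) for m², and the a priori bounds
  -- handle the two counts.
  scaled-step : ∀ k j → j ≤ k → suc k ≤ n →
    scaled k j ≤ (1 + errorBound k j) * m ^ suc k →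
    scaled k k ≤ (1 + errorBound k k) * m ^ suc k →
    c * ∣ scaled (suc k) (suc j) - scaled (suc k) j ∣
      ≤ 2 * ((1 + errorBound k j) * (1 + errorBound k k)) * m ^ suc (suc k)
  scaled-step k j j≤k k<n bound-j bound-k = m*m≤n*n⇒m≤n (begin
    (c * ∣ scaled (suc k) (suc j) - scaled (suc k) j ∣) * (c * ∣ scaled (suc k) (suc j) - scaled (suc k) j ∣)
      ≡⟨ cong (λ x → c * x * (c * x)) factor ⟩
    (c * (p * D)) * (c * (p * D))
      ≡⟨ regroup₁ c p D ⟩
    c * c * (p * p) * (D * D)
      ≤⟨ *-monoʳ-≤ (c * c * (p * p)) (pointed-step k j j≤k E-unique E-unique) ⟩
    c * c * (p * p) * (4 * q ^ (d + 2) * (pointed k j E E * ordered (suc k) E))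
      ≡⟨ cong (λ x → c * c * x * (4 * q ^ (d + 2) * (pointed k j E E * ordered (suc k) E))) pp ⟩
    c * c * (q ^ (k + j) * q ^ (k C 2 + j) * q ^ (suc k C 2)) * (4 * q ^ (d + 2) * (pointed k j E E * ordered (suc k) E))
      ≡⟨ regroup₂ (c * c) (q ^ (k + j)) (q ^ (k C 2 + j)) (q ^ (suc k C 2)) (q ^ (d + 2)) (pointed k j E E) (ordered (suc k) E) ⟩
    4 * (c * c * (q ^ (d + 2) * q ^ (k + j))) * (scaled k j * (q ^ (suc k C 2) * ordered (suc k) E))
      ≡⟨ cong₂ (λ x y → 4 * (c * c * x) * (scaled k j * y)) (sym (^-distribˡ-+-* q (d + 2) (k + j))) (scaled-ordered k) ⟩
    4 * (c * c * q ^ (d + 2 + (k + j))) * (scaled k j * scaled k k)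
      ≤⟨ *-mono-≤ (*-monoʳ-≤ 4 (≤-trans (*-monoʳ-≤ (c * c) (^-monoʳ-≤ q exponent)) large)) (*-mono-≤ bound-j bound-k) ⟩
    4 * (m * m) * (u * M * (v * M))
      ≡⟨ regroup₃ m M u v ⟩
    4 * (u * v) * (m * M * (m * M))
      -- `u * v` is at least 1; squaring it makes the right side a perfect square.
      ≤⟨ *-monoˡ-≤ (m * M * (m * M)) (*-monoʳ-≤ 4 (m≤m*n (u * v) (u * v))) ⟩
    4 * (u * v * (u * v)) * (m * M * (m * M))
      ≡⟨ regroup₄ (u * v) (m * M) ⟩
    (2 * (u * v) * (m * M)) * (2 * (u * v) * (m * M)) ∎)
    where
    open ≤-Reasoning
    p = q ^ (suc k C 2 + j)
    D = ∣ q * pointed (suc k) (suc j) E E - pointed (suc k) j E E ∣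
    M = m ^ suc k
    u = 1 + errorBound k j
    v = 1 + errorBound k k
    factor : ∣ scaled (suc k) (suc j) - scaled (suc k) j ∣ ≡ p * D
    factor = trans (cong (λ x → ∣ x - scaled (suc k) j ∣) shift)
                   (sym (*-distribˡ-∣-∣ p (q * pointed (suc k) (suc j) E E) (pointed (suc k) j E E)))
      where
      swap : ∀ a b c → (a * b) * c ≡ b * (a * c)
      swap = solve-∀
      shift : scaled (suc k) (suc j) ≡ p * (q * pointed (suc k) (suc j) E E)
      shift = trans (cong (λ e → q ^ e * pointed (suc k) (suc j) E E) (+-suc (suc k C 2) j))
                    (swap q p (pointed (suc k) (suc j) E E))
    pp : p * p ≡ q ^ (k + j) * q ^ (k C 2 + j) * q ^ (suc k C 2)
    pp rewrite [1+k]C2 k | ^-distribˡ-+-* q (k C 2 + k) j | ^-distribˡ-+-* q (k C 2) k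
             | ^-distribˡ-+-* q (k C 2) j | ^-distribˡ-+-* q k j = identity (q ^ (k C 2)) (q ^ k) (q ^ j)
      where
      identity : ∀ a b c → (a * b * c) * (a * b * c) ≡ b * c * (a * c) * (a * b)
      identity = solve-∀
    exponent : d + 2 + (k + j) ≤ d + 2 * n
    exponent = begin
      d + 2 + (k + j)    ≤⟨ +-monoʳ-≤ (d + 2) (+-monoʳ-≤ k j≤k) ⟩
      d + 2 + (k + k)    ≡⟨ identity d k ⟩
      d + 2 * (1 + k)    ≤⟨ +-monoʳ-≤ d (*-monoʳ-≤ 2 k<n) ⟩
      d + 2 * n          ∎
      where
      identity : ∀ d k → d + 2 + (k + k) ≡ d + 2 * (1 + k)
      identity = solve-∀
    regroup₁ : ∀ c p x → (c * (p * x)) * (c * (p * x)) ≡ c * c * (p * p) * (x * x)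
    regroup₁ = solve-∀
    regroup₂ : ∀ c a b e f h o → c * (a * b * e) * (4 * f * (h * o)) ≡ 4 * (c * (f * a)) * (b * h * (e * o))
    regroup₂ = solve-∀
    regroup₃ : ∀ m M u v → 4 * (m * m) * (u * M * (v * M)) ≡ 4 * (u * v) * (m * M * (m * M))
    regroup₃ = solve-∀
    regroup₄ : ∀ w x → 4 * (w * w) * (x * x) ≡ (2 * w * x) * (2 * w * x)
    regroup₄ = solve-∀

  -- Lexicographic induction. At j = 0 the marked vertex is unconstrained, so (k+1, 0) is m times
  -- (k, k). The pair (k+1, j+1) follows from (k+1, j), with upper bounds drawn from (k, j) and (k,
  -- k).
  scaled-approx : ∀ k j → j ≤ k → k ≤ n → c * ∣ scaled k j - m ^ suc k ∣ ≤ errorBound k j * m ^ suc k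
  scaled-approx zero zero _ _
    rewrite *-identityˡ (m * 1) | ∣n-n∣≡0 (m * 1) | *-zeroʳ c = z≤n
  scaled-approx (suc k) zero _ k<n = begin
    c * ∣ scaled (suc k) 0 - m * M ∣     ≡⟨ cong (λ x → c * ∣ x - m * M ∣) factor ⟩
    c * ∣ m * scaled k k - m * M ∣       ≡⟨ cong (c *_) (*-distribˡ-∣-∣ m (scaled k k) M) ⟨
    c * (m * ∣ scaled k k - M ∣)         ≡⟨ swap c m ∣ scaled k k - M ∣ ⟩
    m * (c * ∣ scaled k k - M ∣)         ≤⟨ *-monoʳ-≤ m (scaled-approx k k ≤-refl (<⇒≤ k<n)) ⟩
    m * (errorBound k k * M)                  ≡⟨ swap m (errorBound k k) M ⟩
    errorBound k k * (m * M)                  ∎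
    where
    open ≤-Reasoning
    M = m ^ suc k
    swap : ∀ a b c → a * (b * c) ≡ b * (a * c)
    swap = solve-∀
    factor : scaled (suc k) 0 ≡ m * scaled k k
    factor = trans (cong (λ e → q ^ e * (m * ordered (suc k) E)) (+-identityʳ (suc k C 2)))
      (trans (swap (q ^ (suc k C 2)) m (ordered (suc k) E)) (cong (m *_) (scaled-ordered k)))
  scaled-approx (suc k) (suc j) (s≤s j≤k) k<n = begin
    c * ∣ scaled (suc k) (suc j) - M ∣
      ≤⟨ *-monoʳ-≤ c (∣-∣-triangle (scaled (suc k) (suc j)) (scaled (suc k) j) M) ⟩
    c * (∣ scaled (suc k) (suc j) - scaled (suc k) j ∣ + ∣ scaled (suc k) j - M ∣)
      ≡⟨ *-distribˡ-+ c ∣ scaled (suc k) (suc j) - scaled (suc k) j ∣ ∣ scaled (suc k) j - M ∣ ⟩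
    c * ∣ scaled (suc k) (suc j) - scaled (suc k) j ∣ + c * ∣ scaled (suc k) j - M ∣
      ≤⟨ +-mono-≤
           (scaled-step k j j≤k k<n
             (dist≤⇒≤ (errorBound k j) (scaled-approx k j j≤k (<⇒≤ k<n)))
             (dist≤⇒≤ (errorBound k k) (scaled-approx k k ≤-refl (<⇒≤ k<n))))
           (scaled-approx (suc k) j (m≤n⇒m≤1+n j≤k) k<n) ⟩
    2 * ((1 + errorBound k j) * (1 + errorBound k k)) * M + errorBound (suc k) j * M
      ≡⟨ *-distribʳ-+ M (2 * ((1 + errorBound k j) * (1 + errorBound k k))) (errorBound (suc k) j) ⟨
    errorBound (suc k) (suc j) * M ∎
    where
    open ≤-Reasoning
    M = m ^ suc (suc k)

  -- For cliques on n+1 vertices, `large` reads |E| ≥ c q^(d/2+n), and the relative error is a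
  -- constant depending on n alone, divided by c.
  ordered-approx : c * ∣ q ^ (suc n C 2) * ordered (suc n) E - m ^ suc n ∣ ≤ errorBound n n * m ^ suc n
  ordered-approx = subst (λ x → c * ∣ x - m ^ suc n ∣ ≤ errorBound n n * m ^ suc n)
    (sym (scaled-ordered n)) (scaled-approx n n ≤-refl ≤-refl)

-- Orthogonality over a finite field is mixing

∑-map : ∀ (f : B → ℕ) (g : A → B) xs → ∑ (map g xs) f ≡ ∑ xs (f ∘ g)
∑-map f g xs = cong sum (sym (map-∘ xs))

∑-cartesianProductWith : ∀ (g : Z → ℕ) (f : A → B → Z) xs ys →
                         ∑ (cartesianProductWith f xs ys) g ≡ ∑[ x ∈ xs ] ∑[ y ∈ ys ] g (f x y)
∑-cartesianProductWith g f []       ys = refl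
∑-cartesianProductWith g f (x ∷ xs) ys = trans
  (∑-++ g (map (f x) ys) (cartesianProductWith f xs ys))
  (cong₂ _+_ (∑-map g (f x) ys) (∑-cartesianProductWith g f xs ys))

f≤∑f : ∀ (f : A → ℕ) {a xs} → a ∈ xs → f a ≤ ∑ xs f
f≤∑f f {a} a∈xs = ≤-trans (m≤m+n (f a) 0) (∑-⊆ f ([] ∷ []) λ { (here refl) → a∈xs })

ι-¬×-dist : ∀ {p q} {P : Set p} {Q : Set q} (P? : Dec P) (Q? : Dec Q) →
            ∣ ι (¬? P? ×-dec Q?) - ι Q? ∣ ≤ ι P?
ι-¬×-dist (yes _) (yes _) = ≤-refl
ι-¬×-dist (yes _) (no  _) = z≤n
ι-¬×-dist (no  _) (yes _) = z≤n
ι-¬×-dist (no  _) (no  _) = z≤n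

module OverField (F : FiniteField) where
  open FiniteField F using (_+F_; _*F_; -F_; 0F; 1F; isHeytingField; enumeration; _≟F_; order≢0; dot; Orthogonal; orthogonal?)
  open IsHeytingField isHeytingField using (isCommutativeRing; #⇒invertible)

  private
    K = Carrier F
    q = order F
    instance
      q≢0 : NonZero q
      q≢0 = order≢0

  commutativeRing : CommutativeRing 0ℓ 0ℓ
  commutativeRing = record { isCommutativeRing = isCommutativeRing }

  module K = CommutativeRing commutativeRing
  open AbelianGroupProperties K.+-abelianGroup using (∙-cancelˡ)

  dot-comm : ∀ {d} (x y : Vec K d) → dot x y ≡ dot y x
  dot-comm []      []      = refl
  dot-comm (a ∷ x) (b ∷ y) = cong₂ _+F_ (K.*-comm a b) (dot-comm x y)

  -- Both equations fix the product of the unknown with a - a′ as s′ - s, and a - a′ is invertible.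
  linear-unique : ∀ {a a′ s s′ b c} → a ≢ a′ →
    b *F a +F s ≡ b *F a′ +F s′ → c *F a +F s ≡ c *F a′ +F s′ → b ≡ c
  linear-unique {a} {a′} {s} {s′} {b} {c} a≢a′ hb hc with #⇒invertible a≢a′
  ... | t⁻¹ , _ , tt⁻¹≡1 = begin
    b                ≡⟨ K.*-identityʳ b ⟨
    b *F 1F          ≡⟨ cong (b *F_) tt⁻¹≡1 ⟨
    b *F (t *F t⁻¹)  ≡⟨ K.*-assoc b t t⁻¹ ⟨
    b *F t *F t⁻¹    ≡⟨ cong (_*F t⁻¹) bt≡ct ⟩
    c *F t *F t⁻¹    ≡⟨ K.*-assoc c t t⁻¹ ⟩
    c *F (t *F t⁻¹)  ≡⟨ cong (c *F_) tt⁻¹≡1 ⟩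
    c *F 1F          ≡⟨ K.*-identityʳ c ⟩
    c                ∎
    where
    open ≡-Reasoning
    t = a +F -F a′
    isolate : ∀ b → b *F a +F s ≡ b *F a′ +F s′ → s +F b *F t ≡ s′
    isolate b h = ∙-cancelˡ (b *F a′) _ _ (begin
      b *F a′ +F (s +F b *F t)      ≡⟨ cong (b *F a′ +F_) (K.+-comm s (b *F t)) ⟩
      b *F a′ +F (b *F t +F s)      ≡⟨ K.+-assoc (b *F a′) (b *F t) s ⟨
      b *F a′ +F b *F t +F s        ≡⟨ cong (_+F s) (K.distribˡ b a′ t) ⟨
      b *F (a′ +F t) +F s           ≡⟨ cong (λ x → b *F x +F s) a′+t≡a ⟩
      b *F a +F s                   ≡⟨ h ⟩
      b *F a′ +F s′                 ∎)
      where
      a′+t≡a : a′ +F t ≡ a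
      a′+t≡a = begin
        a′ +F (a +F -F a′)  ≡⟨ K.+-comm a′ t ⟩
        a +F -F a′ +F a′    ≡⟨ K.+-assoc a (-F a′) a′ ⟩
        a +F (-F a′ +F a′)  ≡⟨ cong (a +F_) (K.-‿inverseˡ a′) ⟩
        a +F 0F             ≡⟨ K.+-identityʳ a ⟩
        a                   ∎
    bt≡ct : b *F t ≡ c *F t
    bt≡ct = ∙-cancelˡ s _ _ (trans (isolate b hb) (sym (isolate c hc)))

  -- Enumerating the field and its vectors, and counting solutions

  elements : List K
  elements = map (Inverse.from enumeration) (allFin q)

  elements-unique : Unique elements
  elements-unique = Unique.map⁺ injective (Unique.allFin⁺ q)
    where
    injective : ∀ {i j} → Inverse.from enumeration i ≡ Inverse.from enumeration j → i ≡ j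
    injective {i} {j} eq = trans (sym (Inverse.strictlyInverseˡ enumeration i))
      (trans (cong (Inverse.to enumeration) eq) (Inverse.strictlyInverseˡ enumeration j))

  ∈-elements : ∀ a → a ∈ elements
  ∈-elements a = subst (_∈ elements) (Inverse.strictlyInverseʳ enumeration a)
    (∈-map⁺ (Inverse.from enumeration) (∈-allFin (Inverse.to enumeration a)))

  length-elements : length elements ≡ q
  length-elements = trans (length-map (Inverse.from enumeration) (allFin q)) (length-tabulate (λ i → i))

  vectors : ∀ d → List (Vec K d)
  vectors zero    = [ [] ]
  vectors (suc d) = cartesianProductWith _∷_ elements (vectors d)

  ∈-vectors : ∀ {d} (x : Vec K d) → x ∈ vectors d
  ∈-vectors []      = here refl
  ∈-vectors (a ∷ x) = ∈-cartesianProductWith⁺ _∷_ (∈-elements a) (∈-vectors x)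

  ∑-elements-const : ∀ c → ∑[ _ ∈ elements ] c ≡ q * c
  ∑-elements-const c = trans (∑-const c elements) (cong (_* c) length-elements)

  length-vectors : ∀ d → length (vectors d) ≡ q ^ d
  length-vectors zero    = refl
  length-vectors (suc d) = begin
    length (vectors (suc d))                       ≡⟨ length≡∑ (vectors (suc d)) ⟩
    ∑[ _ ∈ vectors (suc d) ] 1                     ≡⟨ ∑-cartesianProductWith (λ _ → 1) _∷_ elements (vectors d) ⟩
    ∑[ _ ∈ elements ] ∑[ _ ∈ vectors d ] 1         ≡⟨ ∑-elements-const (∑[ _ ∈ vectors d ] 1) ⟩
    q * ∑[ _ ∈ vectors d ] 1                       ≡⟨ cong (q *_) (length≡∑ (vectors d)) ⟨
    q * length (vectors d)                         ≡⟨ cong (q *_) (length-vectors d) ⟩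
    q * q ^ d                                      ∎
    where open ≡-Reasoning

  ∑-vectors-const : ∀ d c → ∑[ _ ∈ vectors d ] c ≡ q ^ d * c
  ∑-vectors-const d c = trans (∑-const c (vectors d)) (cong (_* c) (length-vectors d))

  -- The number of y orthogonal to x - x′, written without vector subtraction.
  coincidences : ∀ {d} → Vec K d → Vec K d → ℕ
  coincidences {d} x x′ = ∑[ y ∈ vectors d ] ι (dot y x ≟F dot y x′)

  coincidences≤ : ∀ {d} (x x′ : Vec K d) → coincidences x x′ ≤ q ^ d
  coincidences≤ {d} x x′ = ≤-trans (∑-mono (λ y → ι≤1 (dot y x ≟F dot y x′)) (vectors d))
    (≤-reflexive (trans (sym (length≡∑ (vectors d))) (length-vectors d)))

  -- If the first coordinates of x and x′ differ, the other coordinates of y leave at most one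
  -- choice for its first. If they agree, the first coordinate of y cancels and is free, and
  -- induction handles the rest.
  q*coincidences≤ : ∀ {d} {x x′ : Vec K d} → x ≢ x′ → q * coincidences x x′ ≤ q ^ d
  q*coincidences≤ {x = []} {[]} x≢x′ = ⊥-elim (x≢x′ refl)
  q*coincidences≤ {suc d} {a ∷ x} {a′ ∷ x′} x≢x′ = *-monoʳ-≤ q
    (≤-trans (≤-reflexive (∑-cartesianProductWith
      (λ y → ι (dot y (a ∷ x) ≟F dot y (a′ ∷ x′))) _∷_ elements (vectors d))) bound)
    where
    open ≤-Reasoning
    agree? : ∀ b (y : Vec K d) → Dec (b *F a +F dot y x ≡ b *F a′ +F dot y x′)
    agree? b y = (b *F a +F dot y x) ≟F (b *F a′ +F dot y x′)
    bound : ∑[ b ∈ elements ] ∑[ y ∈ vectors d ] ι (agree? b y) ≤ q ^ d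
    bound with a ≟F a′
    ... | no a≢a′ = begin
      ∑[ b ∈ elements ] ∑[ y ∈ vectors d ] ι (agree? b y)
        ≡⟨ ∑-swap (λ b y → ι (agree? b y)) elements (vectors d) ⟩
      ∑[ y ∈ vectors d ] ∑[ b ∈ elements ] ι (agree? b y)
        ≤⟨ ∑-mono (λ y → ∑-ι≤1 (λ b → agree? b y) elements-unique (linear-unique a≢a′)) (vectors d) ⟩
      ∑[ y ∈ vectors d ] 1
        ≡⟨ trans (sym (length≡∑ (vectors d))) (length-vectors d) ⟩
      q ^ d ∎
    ... | yes refl = begin
      ∑[ b ∈ elements ] ∑[ y ∈ vectors d ] ι (agree? b y)
        ≡⟨ ∑-cong (λ b → ∑-cong (λ y → ι-⇔ (mk⇔ (∙-cancelˡ (b *F a) _ _) (cong (b *F a +F_)))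
             (agree? b y) (dot y x ≟F dot y x′)) (vectors d)) elements ⟩
      ∑[ b ∈ elements ] coincidences x x′
        ≡⟨ ∑-elements-const (coincidences x x′) ⟩
      q * coincidences x x′
        ≤⟨ q*coincidences≤ (x≢x′ ∘ cong (a ∷_)) ⟩
      q ^ d ∎

  _≟V_ : ∀ {d} → DecidableEquality (Vec K d)
  _≟V_ = ≡-dec _≟F_

  ∑-coincidences : ∀ {d} {S : List (Vec K d)} → Unique S →
    q * ∑[ x ∈ S ] ∑[ x′ ∈ S ] coincidences x′ x ≤ length S * (length S * q ^ d + q * q ^ d)
  ∑-coincidences {d} {S} uS = begin
    q * ∑[ x ∈ S ] ∑[ x′ ∈ S ] coincidences x′ x
      ≡⟨ ∑-*ˡ q (λ x → ∑[ x′ ∈ S ] coincidences x′ x) S ⟨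
    ∑[ x ∈ S ] (q * ∑[ x′ ∈ S ] coincidences x′ x)
      ≤⟨ ∑-mono inner S ⟩
    ∑[ _ ∈ S ] (length S * q ^ d + q * q ^ d)
      ≡⟨ ∑-const (length S * q ^ d + q * q ^ d) S ⟩
    length S * (length S * q ^ d + q * q ^ d) ∎
    where
    open ≤-Reasoning
    -- Granting the off-diagonal bound `q ^ d` to the diagonal as well lets one formula cover both
    -- cases.
    term : ∀ x x′ → q * coincidences x′ x ≤ q ^ d + q * q ^ d * ι (x′ ≟V x)
    term x x′ with x′ ≟V x
    ... | no x′≢x = ≤-trans (q*coincidences≤ x′≢x) (m≤m+n (q ^ d) _)
    ... | yes _   = ≤-trans (*-monoʳ-≤ q (coincidences≤ x′ x))
      (≤-trans (≤-reflexive (sym (*-identityʳ (q * q ^ d)))) (m≤n+m _ (q ^ d)))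
    inner : ∀ x → q * ∑[ x′ ∈ S ] coincidences x′ x ≤ length S * q ^ d + q * q ^ d
    inner x = begin
      q * ∑[ x′ ∈ S ] coincidences x′ x
        ≡⟨ ∑-*ˡ q (λ x′ → coincidences x′ x) S ⟨
      ∑[ x′ ∈ S ] (q * coincidences x′ x)
        ≤⟨ ∑-mono (term x) S ⟩
      ∑[ x′ ∈ S ] (q ^ d + q * q ^ d * ι (x′ ≟V x))
        ≡⟨ ∑-distrib-+ (λ _ → q ^ d) (λ x′ → q * q ^ d * ι (x′ ≟V x)) S ⟩
      ∑[ _ ∈ S ] (q ^ d) + ∑[ x′ ∈ S ] (q * q ^ d * ι (x′ ≟V x))
        ≡⟨ cong₂ _+_ (∑-const (q ^ d) S) (∑-*ˡ (q * q ^ d) (λ x′ → ι (x′ ≟V x)) S) ⟩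
      length S * q ^ d + q * q ^ d * ∑[ x′ ∈ S ] ι (x′ ≟V x)
        ≤⟨ +-monoʳ-≤ (length S * q ^ d) (*-monoʳ-≤ (q * q ^ d)
             (∑-ι≤1 (_≟V x) uS (λ y≡x z≡x → trans y≡x (sym z≡x)))) ⟩
      length S * q ^ d + q * q ^ d * 1
        ≡⟨ cong (_+_ (length S * q ^ d)) (*-identityʳ (q * q ^ d)) ⟩
      length S * q ^ d + q * q ^ d ∎

  -- Second moment of the fibre sizes

  module _ {d} (S : List (Vec K d)) where

    private m = length S

    fiber : Vec K d → K → ℕ
    fiber y c = ∑[ x ∈ S ] ι (dot y x ≟F c)

    deviation² : Vec K d → K → ℕ
    deviation² y c = ∣ q * fiber y c - m ∣ * ∣ q * fiber y c - m ∣

    -- Sorts the points of `S` by their value `dot y x`. Taking g = 1 gives the first moment of the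
    -- fibres, g = `fiber y` the second.
    ∑-fiber-* : ∀ y (g : K → ℕ) → ∑[ c ∈ elements ] (fiber y c * g c) ≡ ∑[ x ∈ S ] g (dot y x)
    ∑-fiber-* y g = begin
      ∑[ c ∈ elements ] (fiber y c * g c)
        ≡⟨ ∑-cong (λ c → trans (*-comm (fiber y c) (g c)) (sym (∑-*ˡ (g c) (λ x → ι (dot y x ≟F c)) S))) elements ⟩
      ∑[ c ∈ elements ] ∑[ x ∈ S ] (g c * ι (dot y x ≟F c))
        ≡⟨ ∑-swap (λ c x → g c * ι (dot y x ≟F c)) elements S ⟩
      ∑[ x ∈ S ] ∑[ c ∈ elements ] (g c * ι (dot y x ≟F c))
        ≡⟨ ∑-cong (λ x → trans (∑-cong (λ c → *-comm (g c) (ι (dot y x ≟F c))) elements)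
             (∑-ι≡ _≟F_ g elements-unique (∈-elements (dot y x)))) S ⟩
      ∑[ x ∈ S ] g (dot y x) ∎
      where open ≡-Reasoning

    -- The variance identity, with the subtracted mean moved to the left. In `dist²` the cross terms
    -- total 2qm² and the constants qm², so a further qm² is added to both sides and cancelled.
    ∑-deviation² : ∀ y → ∑ elements (deviation² y) + q * (m * m) ≡ q * q * ∑[ x ∈ S ] fiber y (dot y x)
    ∑-deviation² y = +-cancelʳ-≡ (q * (m * m)) _ _ (begin
      ∑ elements (deviation² y) + q * (m * m) + q * (m * m)
        ≡⟨ rearrange (∑ elements (deviation² y)) q m ⟩
      ∑ elements (deviation² y) + 2 * q * m * m
        ≡⟨ cong (_+_ (∑ elements (deviation² y))) linear ⟨
      ∑ elements (deviation² y) + ∑[ c ∈ elements ] (2 * (q * fiber y c * m))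
        ≡⟨ ∑-distrib-+ (deviation² y) (λ c → 2 * (q * fiber y c * m)) elements ⟨
      ∑[ c ∈ elements ] (deviation² y c + 2 * (q * fiber y c * m))
        ≡⟨ ∑-cong (λ c → dist² (q * fiber y c) m) elements ⟩
      ∑[ c ∈ elements ] (q * fiber y c * (q * fiber y c) + m * m)
        ≡⟨ ∑-distrib-+ (λ c → q * fiber y c * (q * fiber y c)) (λ _ → m * m) elements ⟩
      ∑[ c ∈ elements ] (q * fiber y c * (q * fiber y c)) + ∑[ _ ∈ elements ] (m * m)
        ≡⟨ cong₂ _+_ quadratic (∑-elements-const (m * m)) ⟩
      q * q * ∑[ x ∈ S ] fiber y (dot y x) + q * (m * m) ∎)
      where
      open ≡-Reasoning
      rearrange : ∀ v q m → v + q * (m * m) + q * (m * m) ≡ v + 2 * q * m * m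
      rearrange = solve-∀
      regroup₁ : ∀ q f m → 2 * (q * f * m) ≡ 2 * q * m * (f * 1)
      regroup₁ = solve-∀
      regroup₂ : ∀ q f → q * f * (q * f) ≡ q * q * (f * f)
      regroup₂ = solve-∀
      linear : ∑[ c ∈ elements ] (2 * (q * fiber y c * m)) ≡ 2 * q * m * m
      linear = begin
        ∑[ c ∈ elements ] (2 * (q * fiber y c * m))
          ≡⟨ ∑-cong (λ c → regroup₁ q (fiber y c) m) elements ⟩
        ∑[ c ∈ elements ] (2 * q * m * (fiber y c * 1))
          ≡⟨ ∑-*ˡ (2 * q * m) (λ c → fiber y c * 1) elements ⟩
        2 * q * m * ∑[ c ∈ elements ] (fiber y c * 1)
          ≡⟨ cong (2 * q * m *_) (trans (∑-fiber-* y (λ _ → 1)) (sym (length≡∑ S))) ⟩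
        2 * q * m * m ∎
      quadratic : ∑[ c ∈ elements ] (q * fiber y c * (q * fiber y c)) ≡ q * q * ∑[ x ∈ S ] fiber y (dot y x)
      quadratic = begin
        ∑[ c ∈ elements ] (q * fiber y c * (q * fiber y c))
          ≡⟨ ∑-cong (λ c → regroup₂ q (fiber y c)) elements ⟩
        ∑[ c ∈ elements ] (q * q * (fiber y c * fiber y c))
          ≡⟨ ∑-*ˡ (q * q) (λ c → fiber y c * fiber y c) elements ⟩
        q * q * ∑[ c ∈ elements ] (fiber y c * fiber y c)
          ≡⟨ cong (q * q *_) (∑-fiber-* y (fiber y)) ⟩
        q * q * ∑[ x ∈ S ] fiber y (dot y x) ∎

    ∑-fiber-dot : ∑[ y ∈ vectors d ] ∑[ x ∈ S ] fiber y (dot y x) ≡ ∑[ x ∈ S ] ∑[ x′ ∈ S ] coincidences x′ x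
    ∑-fiber-dot = trans (∑-swap (λ y x → fiber y (dot y x)) (vectors d) S)
      (∑-cong (λ x → ∑-swap (λ y x′ → ι (dot y x′ ≟F dot y x)) (vectors d) S) S)

    -- The m² part of `∑-coincidences` is exactly the mean term and cancels. What survives is the
    -- diagonal, q² q^d m.
    ∑∑-deviation² : Unique S → ∑[ y ∈ vectors d ] ∑ elements (deviation² y) ≤ q ^ (d + 2) * m
    ∑∑-deviation² uS = +-cancelʳ-≤ (q ^ d * (q * (m * m))) _ _ (begin
      ∑[ y ∈ vectors d ] ∑ elements (deviation² y) + q ^ d * (q * (m * m))
        ≡⟨ cong (_+_ (∑[ y ∈ vectors d ] ∑ elements (deviation² y))) (∑-vectors-const d (q * (m * m))) ⟨
      ∑[ y ∈ vectors d ] ∑ elements (deviation² y) + ∑[ _ ∈ vectors d ] (q * (m * m))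
        ≡⟨ ∑-distrib-+ (λ y → ∑ elements (deviation² y)) (λ _ → q * (m * m)) (vectors d) ⟨
      ∑[ y ∈ vectors d ] (∑ elements (deviation² y) + q * (m * m))
        ≡⟨ ∑-cong ∑-deviation² (vectors d) ⟩
      ∑[ y ∈ vectors d ] (q * q * ∑[ x ∈ S ] fiber y (dot y x))
        ≡⟨ ∑-*ˡ (q * q) (λ y → ∑[ x ∈ S ] fiber y (dot y x)) (vectors d) ⟩
      q * q * ∑[ y ∈ vectors d ] ∑[ x ∈ S ] fiber y (dot y x)
        ≡⟨ cong (q * q *_) ∑-fiber-dot ⟩
      q * q * ∑[ x ∈ S ] ∑[ x′ ∈ S ] coincidences x′ x
        ≡⟨ *-assoc q q (∑[ x ∈ S ] ∑[ x′ ∈ S ] coincidences x′ x) ⟩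
      q * (q * ∑[ x ∈ S ] ∑[ x′ ∈ S ] coincidences x′ x)
        ≤⟨ *-monoʳ-≤ q (∑-coincidences uS) ⟩
      q * (m * (m * q ^ d + q * q ^ d))
        ≡⟨ regroup q (q ^ d) m ⟩
      q ^ d * (q * (q * 1)) * m + q ^ d * (q * (m * m))
        ≡⟨ cong (λ x → x * m + q ^ d * (q * (m * m))) (^-distribˡ-+-* q d 2) ⟨
      q ^ (d + 2) * m + q ^ d * (q * (m * m)) ∎)
      where
      open ≤-Reasoning
      regroup : ∀ q p m → q * (m * (m * p + q * p)) ≡ p * (q * (q * 1)) * m + p * (q * (m * m))
      regroup = solve-∀

    ∑-deviation²-0 : ∀ {P} → Unique P → Unique S → ∑[ y ∈ P ] deviation² y 0F ≤ q ^ (d + 2) * m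
    ∑-deviation²-0 {P} uP uS = begin
      ∑[ y ∈ P ] deviation² y 0F
        ≤⟨ ∑-mono (λ y → f≤∑f (deviation² y) (∈-elements 0F)) P ⟩
      ∑[ y ∈ P ] ∑ elements (deviation² y)
        ≤⟨ ∑-⊆ (λ y → ∑ elements (deviation² y)) uP (λ {y} _ → ∈-vectors y) ⟩
      ∑[ y ∈ vectors d ] ∑ elements (deviation² y)
        ≤⟨ ∑∑-deviation² uS ⟩
      q ^ (d + 2) * m ∎
      where open ≤-Reasoning

  -- Cauchy-Schwarz against the constant 1 contributes `length P`, the variance at c = 0 the rest.
  -- Self-orthogonal vectors common to `P` and `S` are still counted here.
  orthogonal-mixing : ∀ {d} {P S : List (Vec K d)} → Unique P → Unique S →
    let e = q * ∑[ y ∈ P ] fiber S y 0F; f = length P * length S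
    in ∣ e - f ∣ * ∣ e - f ∣ ≤ q ^ (d + 2) * f
  orthogonal-mixing {d} {P} {S} uP uS = begin
    ∣ e - f ∣ * ∣ e - f ∣
      ≡⟨ cong₂ (λ x y → ∣ x - y ∣ * ∣ x - y ∣) (∑-*ˡ q (λ y → fiber S y 0F) P) (∑-const (length S) P) ⟨
    ∣ e′ - f′ ∣ * ∣ e′ - f′ ∣
      ≤⟨ cauchy-schwarz-dist 1 (λ y → q * fiber S y 0F) (λ _ → length S) (λ _ → 1) (λ y → deviation² S y 0F)
           (λ y → ≤-reflexive (sym (trans (*-identityˡ (1 * deviation² S y 0F)) (*-identityˡ (deviation² S y 0F))))) P ⟩
    1 * (∑[ _ ∈ P ] 1 * ∑[ y ∈ P ] deviation² S y 0F)
      ≡⟨ trans (*-identityˡ _) (cong (_* ∑[ y ∈ P ] deviation² S y 0F) (sym (length≡∑ P))) ⟩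
    length P * ∑[ y ∈ P ] deviation² S y 0F
      ≤⟨ *-monoʳ-≤ (length P) (∑-deviation²-0 S uP uS) ⟩
    length P * (q ^ (d + 2) * length S)
      ≡⟨ swap (length P) (q ^ (d + 2)) (length S) ⟩
    q ^ (d + 2) * f ∎
    where
    open ≤-Reasoning
    e = q * ∑[ y ∈ P ] fiber S y 0F
    f = length P * length S
    e′ = ∑[ y ∈ P ] (q * fiber S y 0F)
    f′ = ∑[ _ ∈ P ] length S
    swap : ∀ a b c → a * (b * c) ≡ b * (a * c)
    swap = solve-∀

  -- Isotropic vectors are orthogonal to themselves; excluding x = y makes the relation irreflexive,
  -- as the factor k! between ordered and unordered cliques demands.
  Adjacent : ∀ {d} → Vec K d → Vec K d → Set
  Adjacent x y = x ≢ y × Orthogonal x y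

  adjacent? : ∀ {d} (x y : Vec K d) → Dec (Adjacent x y)
  adjacent? x y = ¬? (x ≟V y) ×-dec orthogonal? x y

  Adjacent-sym : ∀ {d} → Symmetric (Adjacent {d})
  Adjacent-sym {x = x} {y} (x≢y , x⊥y) = x≢y ∘ sym , trans (dot-comm y x) x⊥y

  -- For duplicate-free lists this is |P ∩ S|, which bounds the number of self-orthogonal pairs
  -- discarded by `Adjacent`.
  loops : ∀ {d} → List (Vec K d) → List (Vec K d) → ℕ
  loops P S = ∑[ y ∈ P ] ∑[ x ∈ S ] ι (y ≟V x)

  loops≤ˡ : ∀ {d} (P : List (Vec K d)) {S} → Unique S → loops P S ≤ length P
  loops≤ˡ P {S} uS = ≤-trans
    (∑-mono (λ y → ∑-ι≤1 (y ≟V_) uS (λ y≡x y≡z → trans (sym y≡x) y≡z)) P) (≤-reflexive (sym (length≡∑ P)))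

  loops≤ʳ : ∀ {d} {P : List (Vec K d)} S → Unique P → loops P S ≤ length S
  loops≤ʳ {P = P} S uP = ≤-trans (≤-reflexive (∑-swap (λ y x → ι (y ≟V x)) P S)) (≤-trans
    (∑-mono (λ x → ∑-ι≤1 (_≟V x) uP (λ y≡x z≡x → trans y≡x (sym z≡x))) S) (≤-reflexive (sym (length≡∑ S))))

  dist-adjacent-orthogonal : ∀ {d} (P S : List (Vec K d)) →
    ∣ ∑[ y ∈ P ] length (filter (adjacent? y) S) - ∑[ y ∈ P ] fiber S y 0F ∣ ≤ loops P S
  dist-adjacent-orthogonal P S = ≤-trans (∑-dist (λ y → length (filter (adjacent? y) S)) (λ y → fiber S y 0F) P)
    (∑-mono at P)
    where
    open ≤-Reasoning
    at : ∀ y → ∣ length (filter (adjacent? y) S) - fiber S y 0F ∣ ≤ ∑[ x ∈ S ] ι (y ≟V x)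
    at y = begin
      ∣ length (filter (adjacent? y) S) - fiber S y 0F ∣
        ≡⟨ cong (λ l → ∣ l - fiber S y 0F ∣) (length-filter≡∑ (adjacent? y) S) ⟩
      ∣ ∑[ x ∈ S ] ι (adjacent? y x) - fiber S y 0F ∣
        ≤⟨ ∑-dist (λ x → ι (adjacent? y x)) (λ x → ι (orthogonal? y x)) S ⟩
      ∑[ x ∈ S ] ∣ ι (adjacent? y x) - ι (orthogonal? y x) ∣
        ≤⟨ ∑-mono (λ x → ι-¬×-dist (y ≟V x) (orthogonal? y x)) S ⟩
      ∑[ x ∈ S ] ι (y ≟V x) ∎

  -- The square of `loops P S` is at most |P||S| and q² ≤ q^(d+2), so dropping the loops costs no
  -- more than the error in `orthogonal-mixing`. Adding two errors of that size gives the factor 4.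
  adjacent-mixing : ∀ {d} → Cliques.IsMixing (adjacent? {d}) q (4 * q ^ (d + 2))
  adjacent-mixing {d} {P} {S} uP uS = begin
    ∣ q * a - f ∣ * ∣ q * a - f ∣
      ≤⟨ *-mono-≤ triangle triangle ⟩
    (q * loops P S + ∣ q * b - f ∣) * (q * loops P S + ∣ q * b - f ∣)
      ≤⟨ cauchy-schwarz₂ (q ^ (d + 2)) (q * loops P S) ∣ q * b - f ∣ (length P) (length S) (length P) (length S)
           loops-bound (orthogonal-mixing uP uS) ⟩
    q ^ (d + 2) * ((length P + length P) * (length S + length S))
      ≡⟨ regroup (q ^ (d + 2)) (length P) (length S) ⟩
    4 * q ^ (d + 2) * f ∎
    where
    open ≤-Reasoning
    a = ∑[ y ∈ P ] length (filter (adjacent? y) S)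
    b = ∑[ y ∈ P ] fiber S y 0F
    f = length P * length S
    regroup : ∀ k p s → k * ((p + p) * (s + s)) ≡ 4 * k * (p * s)
    regroup = solve-∀
    square : ∀ q l → q * l * (q * l) ≡ q * (q * 1) * (l * l)
    square = solve-∀
    triangle : ∣ q * a - f ∣ ≤ q * loops P S + ∣ q * b - f ∣
    triangle = ≤-trans (∣-∣-triangle (q * a) (q * b) f) (+-monoˡ-≤ ∣ q * b - f ∣
      (≤-trans (≤-reflexive (sym (*-distribˡ-∣-∣ q a b))) (*-monoʳ-≤ q (dist-adjacent-orthogonal P S))))
    loops-bound : q * loops P S * (q * loops P S) ≤ q ^ (d + 2) * f
    loops-bound = begin
      q * loops P S * (q * loops P S)   ≡⟨ square q (loops P S) ⟩
      q ^ 2 * (loops P S * loops P S)   ≤⟨ *-mono-≤ (^-monoʳ-≤ q (m≤n+m 2 d)) (*-mono-≤ (loops≤ˡ P uS) (loops≤ʳ S uP)) ⟩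
      q ^ (d + 2) * f                   ∎

-- Asymptotics in ℚ

∣m⊖n∣≡∣m-n∣ : ∀ m n → ℤ.∣ m ℤ.⊖ n ∣ ≡ ∣ m - n ∣
∣m⊖n∣≡∣m-n∣ zero    zero    = refl
∣m⊖n∣≡∣m-n∣ zero    (suc n) = refl
∣m⊖n∣≡∣m-n∣ (suc m) zero    = refl
∣m⊖n∣≡∣m-n∣ (suc m) (suc n) = trans (cong ℤ.∣_∣ (ℤ.[1+m]⊖[1+n]≡m⊖n m n)) (∣m⊖n∣≡∣m-n∣ m n)

toℚᵘ-/ : ∀ i n .{{_ : NonZero n}} → toℚᵘ (i ℚ./ n) ℚᵘ.≃ (i ℚᵘ./ n)
toℚᵘ-/ i (suc n) = ℚ.toℚᵘ-fromℚᵘ (ℚᵘ.mkℚᵘ i n)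

-- The value at y = 0 is a convention for the empty set, where the count and the main term both
-- vanish.
relativeError : ℕ → ℕ → ℚ
relativeError x zero      = 0ℚ
relativeError x y@(suc _) = (x ℤ.⊖ y) ℚ./ y

-- For y > 0 the error is (ct - y)/y, so 1 plus it is ct/y. In unnormalised rationals this becomes a
-- polynomial identity over ℤ.
relativeError-exact : ∀ t y c .{{_ : NonZero c}} → (y ≡ 0 → t ≡ 0) →
  + t ℚ./ 1 ≡ (1ℚ ℚ.+ relativeError (c * t) y) ℚ.* (+ y ℚ./ c)
relativeError-exact t zero c t≡0 rewrite t≡0 refl =
  sym (trans (cong ((1ℚ ℚ.+ 0ℚ) ℚ.*_) (ℚ.0/n≡0 c)) (ℚ.*-zeroʳ (1ℚ ℚ.+ 0ℚ)))
relativeError-exact t y@(suc y-1) c@(suc c-1) _ = ℚ.toℚᵘ-injective (begin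
  toℚᵘ (+ t ℚ./ 1)
    ≈⟨ toℚᵘ-/ (+ t) 1 ⟩
  + t ℚᵘ./ 1
    ≈⟨ ℚᵘ.*≡* cross ⟩
  (ℚᵘ.1ℚᵘ ℚᵘ.+ ((c * t) ℤ.⊖ y) ℚᵘ./ y) ℚᵘ.* (+ y ℚᵘ./ c)
    ≈⟨ ℚᵘ.*-cong (ℚᵘ.+-congʳ ℚᵘ.1ℚᵘ (toℚᵘ-/ ((c * t) ℤ.⊖ y) y)) (toℚᵘ-/ (+ y) c) ⟨
  (ℚᵘ.1ℚᵘ ℚᵘ.+ toℚᵘ δ) ℚᵘ.* toℚᵘ (+ y ℚ./ c)
    ≈⟨ ℚᵘ.*-congʳ (ℚ.toℚᵘ-homo-+ 1ℚ δ) ⟨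
  toℚᵘ (1ℚ ℚ.+ δ) ℚᵘ.* toℚᵘ (+ y ℚ./ c)
    ≈⟨ ℚ.toℚᵘ-homo-* (1ℚ ℚ.+ δ) (+ y ℚ./ c) ⟨
  toℚᵘ ((1ℚ ℚ.+ δ) ℚ.* (+ y ℚ./ c)) ∎)
  where
  open ≈-Reasoning ℚᵘ.≃-setoid
  δ = relativeError (c * t) y
  identity : ∀ t y c → t ℤ.* ((+ 1 ℤ.* y) ℤ.* c) ≡
             (((+ 1) ℤ.* y ℤ.+ (c ℤ.* t ℤ.+ ℤ.- y) ℤ.* + 1) ℤ.* y) ℤ.* + 1
  identity = ℤSolver.solve-∀
  cross : + t ℤ.* + (1 * y * c) ≡ (((+ 1) ℤ.* + y ℤ.+ ((c * t) ℤ.⊖ y) ℤ.* + 1) ℤ.* + y) ℤ.* + 1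
  cross = trans
    (cong (+ t ℤ.*_) (trans (ℤ.pos-* (1 * y) c) (cong (ℤ._* + c) (ℤ.pos-* 1 y))))
    (trans (identity (+ t) (+ y) (+ c))
      (cong (λ z → (((+ 1) ℤ.* + y ℤ.+ z ℤ.* + 1) ℤ.* + y) ℤ.* + 1)
        (trans (cong (ℤ._+ ℤ.- (+ y)) (sym (ℤ.pos-* c t))) (ℤ.m-n≡m⊖n (c * t) y))))

-- A positive ε is at least 1 over its denominator, so an error below that reciprocal suffices.
relativeError-small : ∀ x y e (ε : ℚ) → 0ℚ ℚ.< ε →
  suc (e * ↧ₙ ε) * ∣ x - y ∣ ≤ e * y → ℚ.∣ relativeError x y ∣ ℚ.< ε
relativeError-small x zero      e ε 0<ε _ = 0<ε
relativeError-small x y@(suc _) e ε@(mkℚ (+ suc a) n-1 _) _ h = ℚ.toℚᵘ-cancel-< (ℚᵘ.<-respˡ-≃ (ℚᵘ.≃-sym abs) (ℚᵘ.*<* small))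
  where
  n = suc n-1
  r = ∣ x - y ∣
  abs : toℚᵘ ℚ.∣ relativeError x y ∣ ℚᵘ.≃ (+ r ℚᵘ./ y)
  abs = ℚᵘ.≃-trans (ℚ.toℚᵘ-homo-∣-∣ (relativeError x y))
    (ℚᵘ.≃-trans (ℚᵘ.∣-∣-cong (toℚᵘ-/ (x ℤ.⊖ y) y)) (ℚᵘ.≃-reflexive (cong (λ z → + z ℚᵘ./ y) (∣m⊖n∣≡∣m-n∣ x y))))
  -- The `suc` in the coefficient leaves a spare `suc r`, which makes the inequality strict; for r =
  -- 0 positivity of y is enough.
  rn<y : ∀ r → suc (e * n) * r ≤ e * y → r * n < y
  rn<y zero    _ = s≤s z≤n
  rn<y (suc r) h = *-cancelˡ-< e (suc r * n) y (begin-strict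
    e * (suc r * n)         ≡⟨ cong (e *_) (*-comm (suc r) n) ⟩
    e * (n * suc r)         ≡⟨ *-assoc e n (suc r) ⟨
    e * n * suc r           <⟨ m<n+m (e * n * suc r) z<s ⟩
    suc r + e * n * suc r   ≤⟨ h ⟩
    e * y                   ∎)
    where open ≤-Reasoning
  small : + r ℤ.* + n ℤ.< + suc a ℤ.* + y
  small = subst₂ ℤ._<_ (ℤ.pos-* r n) (ℤ.pos-* (suc a) y)
    (ℤ.+<+ (<-≤-trans (rn<y r h) (m≤n*m y (suc a))))
relativeError-small x y@(suc _) e (mkℚ (+ zero) n-1 _) (*<* (ℤ.+<+ ())) _
relativeError-small x y@(suc _) e (mkℚ ℤ.-[1+ a ] n-1 _) (*<* ()) _

-- From cliques of distinct orthogonal vectors to `orthogonalTuples`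

module _ (F : FiniteField) {d : ℕ} where
  open FiniteField F using (orthogonal?; order≢0)
  open OverField F
  private
    module O = Cliques (orthogonal? {d})
    module A = Cliques (adjacent? {d})
    q = order F
    instance
      q≢0 : NonZero q
      q≢0 = order≢0

  -- `cliques` compares a vertex only with later entries, which in a duplicate-free list are
  -- distinct from it.
  cliques-adjacent : ∀ k {E} → Unique E → O.cliques k E ≡ A.cliques k E
  cliques-adjacent zero    _ = refl
  cliques-adjacent (suc k) [] = refl
  cliques-adjacent (suc k) {x ∷ E} (x∉E ∷ uE) = cong₂ _+_
    (trans (cliques-adjacent k (Unique.filter⁺ (orthogonal? x) uE)) (cong (A.cliques k) nbrs))
    (cliques-adjacent (suc k) uE)
    where
    nbrs : O.nbr x E ≡ A.nbr x E
    nbrs = filter-cong (orthogonal? x) (adjacent? x)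
      (All.map (λ {y} x≢y → does-⇔ (mk⇔ (x≢y ,_) proj₂) (orthogonal? x y) (adjacent? x y)) x∉E)

  ordered≡!*tuples : ∀ k {E} → Unique E → A.ordered k E ≡ k ! * orthogonalTuples F k E
  ordered≡!*tuples k {E} uE = trans
    (A.SymmetricCliques.Loopless.ordered≡!*cliques Adjacent-sym (λ { (x≢x , _) → x≢x refl }) k E)
    (cong (k ! *_) (sym (trans (O.length-filter-combinations k E) (cliques-adjacent k uE))))

  tuples-approx : ∀ n {E} → Unique E → ∀ c .{{_ : NonZero c}} →
    c ^ 2 * q ^ (d + 2 * n) ≤ length E ^ 2 →
    let k = suc n in
    c * ∣ k ! * q ^ (k C 2) * orthogonalTuples F k E - length E ^ k ∣ ≤ errorBound n n * length E ^ k
  tuples-approx n {E} uE c large = subst (λ x → c * ∣ x - length E ^ k ∣ ≤ errorBound n n * length E ^ k)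
    (trans (cong (q ^ (k C 2) *_) (ordered≡!*tuples k uE)) (regroup (q ^ (k C 2)) (k !) (orthogonalTuples F k E)))
    (MixingCliques.ordered-approx adjacent? Adjacent-sym q d adjacent-mixing E uE c n
      (subst₂ (λ x y → x * q ^ (d + 2 * n) ≤ y) (square c) (square (length E)) large))
    where
    k = suc n
    regroup : ∀ a b t → a * (b * t) ≡ b * a * t
    regroup = solve-∀
    square : ∀ x → x ^ 2 ≡ x * x
    square x = cong (x *_) (*-identityʳ x)

  -- Covers the conventional case of `relativeError`. A positive tuple size matters: the empty set
  -- does contain one 0-tuple.
  tuples-empty : ∀ n (E : List (Vec (Carrier F) d)) → length E ^ suc n ≡ 0 → orthogonalTuples F (suc n) E ≡ 0
  tuples-empty n []      _  = refl
  tuples-empty n (_ ∷ E) eq with () ← m^n≡0⇒m≡0 (suc (length E)) (suc n) eq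

theorem2 :
    ∀ {ℓ : Level} (d k : ℕ) .{{_ : NonZero d}} .{{_ : NonZero k}} → 2 * k ∸ 1 ≤ d →
    (I : Set ℓ) (F : I → FiniteField) (E : (i : I) → List (Vec (Carrier (F i)) d)) →
    (∀ i → Unique (E i)) →
    let q = λ i → order (F i)
        open Asymptotics q
    in (λ i → length (E i)) ≫√ (λ i → q i ^ (d + 2 * (k ∸ 1))) →
       Σ[ δ ∈ (I → ℚ) ] (IsLittleO1 δ ×
         (∀ i → (+ orthogonalTuples (F i) k (E i)) ℚ./ 1 ≡ (1ℚ ℚ.+ δ i) ℚ.* mainTerm (F i) k (E i)))
theorem2 d zero {{_}} {{0≢0}} _ _ _ _ _ _ = ⊥-elim (≢-nonZero⁻¹ 0 {{0≢0}} refl)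
theorem2 d (suc n) _ I F E uE large = δ , δ→0 , exact
  where
  k = suc n
  open Asymptotics (λ i → order (F i))
  scale : I → ℕ
  scale i = k ! * order (F i) ^ (k C 2)
  -- Chosen so that the required equation holds exactly; the asymptotic content is all in `δ→0`.
  δ : I → ℚ
  δ i = relativeError (scale i * orthogonalTuples (F i) k (E i)) (length (E i) ^ k)
  δ→0 : IsLittleO1 δ
  -- This c exceeds `errorBound n n` times the denominator of ε, so the relative error
  -- `errorBound n n` / c falls below ε.
  δ→0 ε 0<ε = let c = suc (errorBound n n * ↧ₙ ε); Q , large-c = large c in
    Q , λ i Q≤q → relativeError-small (scale i * orthogonalTuples (F i) k (E i)) (length (E i) ^ k) (errorBound n n) ε 0<ε
      (tuples-approx (F i) n (uE i) c (large-c i Q≤q))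
  exact : ∀ i → (+ orthogonalTuples (F i) k (E i)) ℚ./ 1 ≡ (1ℚ ℚ.+ δ i) ℚ.* mainTerm (F i) k (E i)
  exact i = relativeError-exact (orthogonalTuples (F i) k (E i)) (length (E i) ^ k) (scale i)
    (tuples-empty (F i) n (E i))
    where
    instance
      _ = FiniteField.order≢0 (F i)
      _ = k !≢0
      _ = m^n≢0 (order (F i)) (k C 2)
      _ = m*n≢0 (k !) (order (F i) ^ (k C 2))
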